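{- System $\mathsf{SKSq}$ and system $\mathsf{SKSgq}$ are strongly equivalent. Also, system $\mathsf{KSq}$ and system $\mathsf{KSgq}$ are strongly equivalent.
   Context: First-order terms are as usual; atoms are expressions $p(t_1,\dots,t_n)$ with $p$ a predicate symbol of arity $n$, and the negation of an atom is again an atom. Structures: $S ::= \mathsf f \mid \mathsf t \mid a \mid [S,\dots,S] \mid (S,\dots,S) \mid \bar S \mid \exists x S \mid \forall x S$ (non-empty lists), with $[\cdot]$ disjunction, $(\cdot)$ conjunction, $\bar S$ negation. A context $S\{\ \}$ is a structure with one occurrence of a hole, not in the scope of a negation; $S\{R\}$ fills the hole with $R$ (quantifiers of $S$ may capture variables of $R$); $S[R,T]$ abbreviates $S\{[R,T]\}$, $S(R,T)$ abbreviates $S\{(R,T)\}$. $R[x/t]$ denotes substitution of the term $t$ for $x$ in $R$, where $t$ must be free for $x$ in $R$. Equivalent structures are not distinguished; equivalence is the smallest equivalence relation induced by: $[\vec R,[\vec T],\vec U]=[\vec R,\vec T,\vec U]$, $(\vec R,(\vec T),\vec U)=(\vec R,\vec T,\vec U)$ ($\vec T$ non-empty); $[R,T]=[T,R]$, $(R,T)=(T,R)$; $(\mathsf f,\mathsf f)=\mathsf f$, $[\mathsf f,R]=R$, $[\mathsf t,\mathsf t]=\mathsf t$, $(\mathsf t,R)=R$; $\bar{\mathsf f}=\mathsf t$, $\bar{\mathsf t}=\mathsf f$, $\overline{[R,T]}=(\bar R,\bar T)$, $\overline{(R,T)}=[\bar R,\bar T]$, $\bar{\bar R}=R$, $\overline{\exists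 xR}=\forall x\bar R$, $\overline{\forall xR}=\exists x\bar R$; $\forall xR=\forall yR[x/y]$ and $\exists xR=\exists yR[x/y]$ if $y$ is not free in $R$; $\forall yR=\exists yR=R$ if $y$ is not free in $R$; and closure: if $R=T$ then $S\{R\}=S\{T\}$ and $\bar R=\bar T$. A derivation in a system (set of inference rules) is a finite sequence of rule instances, read top-down, the conclusion of each being the premise of the next; it may consist of a single structure. Its premise is the topmost structure, its conclusion the bottommost. Rules (written $\frac{\text{premise}}{\text{conclusion}}$; $a$ an atom, $R,T,U,V$ structures): $i{\downarrow}:\frac{S\{\mathsf t\}}{S[R,\bar R]}$, $i{\uparrow}:\frac{S(R,\bar R)}{S\{\mathsf f\}}$, $w{\downarrow}:\frac{S\{\mathsf f\}}{S\{R\}}$, $w{\uparrow}:\frac{S\{R\}}{S\{\mathsf t\}}$, $c{\downarrow}:\frac{S[R,R]}{S\{R\}}$, $c{\uparrow}:\frac{S\{R\}}{S(R,R)}$; $ai{\downarrow},ai{\uparrow},aw{\downarrow},aw{\uparrow},ac{\downarrow},ac{\uparrow}$ are these six rules respectively with $R$ restricted to be an atom $a$; $s:\frac{S([R,U],T)}{S[(R,T),U]}$, $m:\frac{S[(R,U),(T,V)]}{S([R,T],[U,V])}$, $u{\downarrow}:\frac{S\{\forall x[R,T]\}}{S[\forall xR,\exists xT]}$, $u{\uparrow}:\frac{S(\exists xR,\forall xT)}{S\{\exists x(R,T)\}}$, $n{\downarrow}:\frac{S\{R[x/t]\}}{S\{\exists xR\}}$, $n{\uparrow}:\frac{S\{\forall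 xR\}}{S\{R[x/t]\}}$, $l_1{\downarrow}:\frac{S[\exists xR,\exists xT]}{S\{\exists x[R,T]\}}$, $l_1{\uparrow}:\frac{S\{\forall x(R,T)\}}{S(\forall xR,\forall xT)}$, $l_2{\downarrow}:\frac{S[\forall xR,\forall xT]}{S\{\forall x[R,T]\}}$, $l_2{\uparrow}:\frac{S\{\exists x(R,T)\}}{S(\exists xR,\exists xT)}$. Systems: $\mathsf{SKSgq}=\{i{\downarrow},i{\uparrow},s,w{\downarrow},w{\uparrow},c{\downarrow},c{\uparrow},u{\downarrow},u{\uparrow},n{\downarrow},n{\uparrow}\}$; $\mathsf{KSgq}=\{i{\downarrow},s,w{\downarrow},c{\downarrow},u{\downarrow},n{\downarrow}\}$; $\mathsf{SKSq}=\{ai{\downarrow},ai{\uparrow},s,m,aw{\downarrow},aw{\uparrow},ac{\downarrow},ac{\uparrow},u{\downarrow},u{\uparrow},l_1{\downarrow},l_1{\uparrow},l_2{\downarrow},l_2{\uparrow},n{\downarrow},n{\uparrow}\}$; $\mathsf{KSq}=\{ai{\downarrow},s,m,aw{\downarrow},ac{\downarrow},u{\downarrow},l_1{\downarrow},l_2{\downarrow},n{\downarrow}\}$. Two systems $\mathcal S,\mathcal S'$ are strongly equivalent if for every derivation in $\mathcal S$ with premise $T$ and conclusion $R$ there is a derivation in $\mathcal S'$ with premise $T$ and conclusion $R$, and vice versa. -}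

module Defs where

open import Data.List.Base using (List; []; _∷_)
open import Data.List.Membership.Propositional using (_∈_)
open import Data.List.NonEmpty.Base using (List⁺; _∷_; toList; _++⁺_; _⁺++_)
open import Data.List.NonEmpty.Relation.Unary.All using (All)
open import Data.List.Relation.Unary.Any using () renaming (Any to AnyList)
open import Data.Nat.Base using (ℕ)
open import Data.Nat.Properties using (_≟_)
open import Data.Vec.Base using (Vec; []; _∷_)
open import Data.Vec.Relation.Unary.Any using () renaming (Any to AnyVec)
open import Function.Bundles using (_⇔_)
open import Relation.Binary.PropositionalEquality using (_≢_)
open import Relation.Nullary.Decidable.Core using (yes; no)
open import Relation.Nullary.Negation.Core using (¬_)

record Signature : Set₁ where
  field
    Func    : Set
    arityᶠ  : Func → ℕ
    Pred    : Set
    arityᵖ  : Pred → ℕ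

Var : Set
Var = ℕ

data Rule : Set where
  i↓ i↑ w↓ w↑ c↓ c↑                    : Rule
  ai↓ ai↑ aw↓ aw↑ ac↓ ac↑              : Rule
  s m u↓ u↑ n↓ n↑ l₁↓ l₁↑ l₂↓ l₂↑      : Rule

System : Set
System = List Rule

SKSgq KSgq SKSq KSq : System
SKSgq = i↓ ∷ i↑ ∷ s ∷ w↓ ∷ w↑ ∷ c↓ ∷ c↑ ∷ u↓ ∷ u↑ ∷ n↓ ∷ n↑ ∷ []
KSgq  = i↓ ∷ s ∷ w↓ ∷ c↓ ∷ u↓ ∷ n↓ ∷ []
SKSq  = ai↓ ∷ ai↑ ∷ s ∷ m ∷ aw↓ ∷ aw↑ ∷ ac↓ ∷ ac↑ ∷ u↓ ∷ u↑
      ∷ l₁↓ ∷ l₁↑ ∷ l₂↓ ∷ l₂↑ ∷ n↓ ∷ n↑ ∷ []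
KSq   = ai↓ ∷ s ∷ m ∷ aw↓ ∷ ac↓ ∷ u↓ ∷ l₁↓ ∷ l₂↓ ∷ n↓ ∷ []

module Calculus (𝓛 : Signature) where

  open Signature 𝓛

  data Term : Set where
    var : Var → Term
    app : (g : Func) → Vec Term (arityᶠ g) → Term

  data Structure : Set where
    𝖿 𝗍   : Structure
    pred  : (p : Pred) → Vec Term (arityᵖ p) → Structure
    ⋁ ⋀   : List⁺ Structure → Structure
    neg   : Structure → Structure
    ∃′ ∀′ : Var → Structure → Structure

  pattern [_,_] R T = ⋁ (R ∷ T ∷ [])
  pattern ⦅_,_⦆ R T = ⋀ (R ∷ T ∷ [])

  -- The negation of an atom as an atom is identified with its negation as a
  -- structure.
  data IsAtom : Structure → Set where
    pred : ∀ {p ts} → IsAtom (pred p ts)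
    neg  : ∀ {a} → IsAtom a → IsAtom (neg a)

  data _∈ᵗ_ (x : Var) : Term → Set where
    var : x ∈ᵗ var x
    app : ∀ {g ts} → AnyVec (x ∈ᵗ_) ts → x ∈ᵗ app g ts

  data _FreeIn_ (x : Var) : Structure → Set where
    pred : ∀ {p ts} → AnyVec (x ∈ᵗ_) ts → x FreeIn pred p ts
    ⋁    : ∀ {Rs} → AnyList (x FreeIn_) (toList Rs) → x FreeIn ⋁ Rs
    ⋀    : ∀ {Rs} → AnyList (x FreeIn_) (toList Rs) → x FreeIn ⋀ Rs
    neg  : ∀ {R} → x FreeIn R → x FreeIn neg R
    ∃′   : ∀ {y R} → x ≢ y → x FreeIn R → x FreeIn ∃′ y R
    ∀′   : ∀ {y R} → x ≢ y → x FreeIn R → x FreeIn ∀′ y R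

  -- No free occurrence of x lies in the scope of a quantifier that binds a
  -- variable of t.
  data FreeFor (t : Term) (x : Var) : Structure → Set where
    𝖿      : FreeFor t x 𝖿
    𝗍      : FreeFor t x 𝗍
    pred   : ∀ {p ts} → FreeFor t x (pred p ts)
    ⋁      : ∀ {Rs} → All (FreeFor t x) Rs → FreeFor t x (⋁ Rs)
    ⋀      : ∀ {Rs} → All (FreeFor t x) Rs → FreeFor t x (⋀ Rs)
    neg    : ∀ {R} → FreeFor t x R → FreeFor t x (neg R)
    ∃-none : ∀ {y R} → ¬ (x FreeIn ∃′ y R) → FreeFor t x (∃′ y R)
    ∀-none : ∀ {y R} → ¬ (x FreeIn ∀′ y R) → FreeFor t x (∀′ y R)
    ∃′     : ∀ {y R} → ¬ (y ∈ᵗ t) → FreeFor t x R → FreeFor t x (∃′ y R)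
    ∀′     : ∀ {y R} → ¬ (y ∈ᵗ t) → FreeFor t x R → FreeFor t x (∀′ y R)

  mutual
    substᵗ : Var → Term → Term → Term
    substᵗ x t (var y) with x ≟ y
    ... | yes _ = t
    ... | no  _ = var y
    substᵗ x t (app g ts) = app g (substᵗˢ x t ts)

    substᵗˢ : ∀ {n} → Var → Term → Vec Term n → Vec Term n
    substᵗˢ x t []       = []
    substᵗˢ x t (u ∷ us) = substᵗ x t u ∷ substᵗˢ x t us

  -- Substitution of free occurrences without renaming of bound variables; it
  -- is used only under the side condition FreeFor t x R.
  infix 9 _[_/_]
  mutual
    _[_/_] : Structure → Term → Var → Structure
    𝖿            [ t / x ] = 𝖿
    𝗍            [ t / x ] = 𝗍
    pred p ts    [ t / x ] = pred p (substᵗˢ x t ts)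
    ⋁ (R ∷ Rs)   [ t / x ] = ⋁ (R [ t / x ] ∷ substˢ x t Rs)
    ⋀ (R ∷ Rs)   [ t / x ] = ⋀ (R [ t / x ] ∷ substˢ x t Rs)
    neg R        [ t / x ] = neg (R [ t / x ])
    ∃′ y R       [ t / x ] with x ≟ y
    ... | yes _ = ∃′ y R
    ... | no  _ = ∃′ y (R [ t / x ])
    ∀′ y R       [ t / x ] with x ≟ y
    ... | yes _ = ∀′ y R
    ... | no  _ = ∀′ y (R [ t / x ])

    substˢ : Var → Term → List Structure → List Structure
    substˢ x t []       = []
    substˢ x t (R ∷ Rs) = R [ t / x ] ∷ substˢ x t Rs

  data Context : Set where
    hole  : Context
    ⋁ ⋀   : List Structure → Context → List Structure → Context
    ∃′ ∀′ : Var → Context → Context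

  infix 10 _⟨_⟩
  _⟨_⟩ : Context → Structure → Structure
  hole      ⟨ R ⟩ = R
  ⋁ Ts S Us ⟨ R ⟩ = ⋁ (Ts ++⁺ (S ⟨ R ⟩ ∷ Us))
  ⋀ Ts S Us ⟨ R ⟩ = ⋀ (Ts ++⁺ (S ⟨ R ⟩ ∷ Us))
  ∃′ x S    ⟨ R ⟩ = ∃′ x (S ⟨ R ⟩)
  ∀′ x S    ⟨ R ⟩ = ∀′ x (S ⟨ R ⟩)

  infix 4 _≈_
  data _≈_ : Structure → Structure → Set where
    ≈-refl  : ∀ {R} → R ≈ R
    ≈-sym   : ∀ {R T} → R ≈ T → T ≈ R
    ≈-trans : ∀ {R T U} → R ≈ T → T ≈ U → R ≈ U

    ⋁-assoc : ∀ Rs Ts Us → ⋁ (Rs ++⁺ (⋁ Ts ∷ Us)) ≈ ⋁ (Rs ++⁺ (Ts ⁺++ Us))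
    ⋀-assoc : ∀ Rs Ts Us → ⋀ (Rs ++⁺ (⋀ Ts ∷ Us)) ≈ ⋀ (Rs ++⁺ (Ts ⁺++ Us))
    ⋁-comm  : ∀ R T → [ R , T ] ≈ [ T , R ]
    ⋀-comm  : ∀ R T → ⦅ R , T ⦆ ≈ ⦅ T , R ⦆

    𝖿-⋀     : ⦅ 𝖿 , 𝖿 ⦆ ≈ 𝖿
    𝖿-⋁     : ∀ R → [ 𝖿 , R ] ≈ R
    𝗍-⋁     : [ 𝗍 , 𝗍 ] ≈ 𝗍
    𝗍-⋀     : ∀ R → ⦅ 𝗍 , R ⦆ ≈ R

    neg-𝖿   : neg 𝖿 ≈ 𝗍
    neg-𝗍   : neg 𝗍 ≈ 𝖿
    neg-⋁   : ∀ R T → neg [ R , T ] ≈ ⦅ neg R , neg T ⦆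
    neg-⋀   : ∀ R T → neg ⦅ R , T ⦆ ≈ [ neg R , neg T ]
    neg-neg : ∀ R → neg (neg R) ≈ R
    neg-∃   : ∀ x R → neg (∃′ x R) ≈ ∀′ x (neg R)
    neg-∀   : ∀ x R → neg (∀′ x R) ≈ ∃′ x (neg R)

    ∀-rename : ∀ x y R → ¬ (y FreeIn R) → FreeFor (var y) x R →
               ∀′ x R ≈ ∀′ y (R [ var y / x ])
    ∃-rename : ∀ x y R → ¬ (y FreeIn R) → FreeFor (var y) x R →
               ∃′ x R ≈ ∃′ y (R [ var y / x ])
    ∀-vacuous : ∀ y R → ¬ (y FreeIn R) → ∀′ y R ≈ R
    ∃-vacuous : ∀ y R → ¬ (y FreeIn R) → ∃′ y R ≈ R

    ≈-context : ∀ S {R T} → R ≈ T → S ⟨ R ⟩ ≈ S ⟨ T ⟩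
    ≈-neg     : ∀ {R T} → R ≈ T → neg R ≈ neg T

  -- Redex ρ P Q: the rule ρ has the instance with premise P and conclusion Q
  -- in the empty context.
  data Redex : Rule → Structure → Structure → Set where
    i↓  : ∀ {R} → Redex i↓ 𝗍 [ R , neg R ]
    i↑  : ∀ {R} → Redex i↑ ⦅ R , neg R ⦆ 𝖿
    w↓  : ∀ {R} → Redex w↓ 𝖿 R
    w↑  : ∀ {R} → Redex w↑ R 𝗍
    c↓  : ∀ {R} → Redex c↓ [ R , R ] R
    c↑  : ∀ {R} → Redex c↑ R ⦅ R , R ⦆

    ai↓ : ∀ {a} → IsAtom a → Redex ai↓ 𝗍 [ a , neg a ]
    ai↑ : ∀ {a} → IsAtom a → Redex ai↑ ⦅ a , neg a ⦆ 𝖿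
    aw↓ : ∀ {a} → IsAtom a → Redex aw↓ 𝖿 a
    aw↑ : ∀ {a} → IsAtom a → Redex aw↑ a 𝗍
    ac↓ : ∀ {a} → IsAtom a → Redex ac↓ [ a , a ] a
    ac↑ : ∀ {a} → IsAtom a → Redex ac↑ a ⦅ a , a ⦆

    s   : ∀ {R T U} → Redex s ⦅ [ R , U ] , T ⦆ [ ⦅ R , T ⦆ , U ]
    m   : ∀ {R T U V} →
          Redex m [ ⦅ R , U ⦆ , ⦅ T , V ⦆ ] ⦅ [ R , T ] , [ U , V ] ⦆

    u↓  : ∀ {x R T} → Redex u↓ (∀′ x [ R , T ]) [ ∀′ x R , ∃′ x T ]
    u↑  : ∀ {x R T} → Redex u↑ ⦅ ∃′ x R , ∀′ x T ⦆ (∃′ x ⦅ R , T ⦆)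
    n↓  : ∀ {x t R} → FreeFor t x R → Redex n↓ (R [ t / x ]) (∃′ x R)
    n↑  : ∀ {x t R} → FreeFor t x R → Redex n↑ (∀′ x R) (R [ t / x ])
    l₁↓ : ∀ {x R T} → Redex l₁↓ [ ∃′ x R , ∃′ x T ] (∃′ x [ R , T ])
    l₁↑ : ∀ {x R T} → Redex l₁↑ (∀′ x ⦅ R , T ⦆) ⦅ ∀′ x R , ∀′ x T ⦆
    l₂↓ : ∀ {x R T} → Redex l₂↓ [ ∀′ x R , ∀′ x T ] (∀′ x [ R , T ])
    l₂↑ : ∀ {x R T} → Redex l₂↑ (∃′ x ⦅ R , T ⦆) ⦅ ∃′ x R , ∃′ x T ⦆

  data Instance (ρ : Rule) : Structure → Structure → Set where
    inst : ∀ S {P Q} → Redex ρ P Q → Instance ρ (S ⟨ P ⟩) (S ⟨ Q ⟩)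

  -- Derivation 𝒮 T R has premise T and conclusion R.  Consecutive structures
  -- are matched up to ≈, since equivalent structures are not distinguished.
  data Derivation (𝒮 : System) : Structure → Structure → Set where
    single : ∀ {T R} → T ≈ R → Derivation 𝒮 T R
    step   : ∀ {ρ T P Q R} → ρ ∈ 𝒮 → T ≈ P → Instance ρ P Q →
             Derivation 𝒮 Q R → Derivation 𝒮 T R

  StronglyEquivalent : System → System → Set
  StronglyEquivalent 𝒮 𝒮′ = ∀ T R → Derivation 𝒮 T R ⇔ Derivation 𝒮′ T R

{-# OPTIONS --safe #-}

-- Up to equivalence every structure is built from units and atoms by binary
-- disjunction and conjunction and the two quantifiers, so the general rules
-- decompose by induction on that generation: s and u merge interactions, m, l₁
-- and l₂ merge contractions, and the units alone merge weakenings.  Conversely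
-- m, l₁ and l₂ each consist of a contraction and two weakenings.
module Submission where

open import Defs
open import Data.List.Base using ([]; _∷_)
open import Data.List.Membership.Propositional using (_∈_)
open import Data.List.NonEmpty.Base using (_∷_)
open import Data.List.Properties using (++-identityʳ)
open import Data.List.Relation.Binary.Subset.Propositional using (_⊆_)
open import Data.List.Relation.Unary.All using (All; []; _∷_; lookup)
open import Data.List.Relation.Unary.Any using (here; there)
open import Data.Product.Base using (_×_; _,_)
open import Function.Base using (id; _∘_)
open import Function.Bundles using (mk⇔)
open import Relation.Binary.Bundles using (Preorder; Setoid)
open import Relation.Binary.PropositionalEquality using (_≡_; refl; cong; subst; subst₂)
import Relation.Binary.Reasoning.Preorder as PreorderReasoning
import Relation.Binary.Reasoning.Setoid as SetoidReasoning

-- Turns the members of a concrete list into local instances; global instances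
-- for here and there would overlap and leave the search undecided.
Assuming : System → System → Set → Set
Assuming 𝒮 []       X = X
Assuming 𝒮 (ρ ∷ ρs) X = ⦃ ρ ∈ 𝒮 ⦄ → Assuming 𝒮 ρs X

-- The inclusion is general because `ρs` shrinks along the induction while `𝒮` stays fixed; the uses
-- below take the whole system for `ρs` and `id` for the inclusion.
discharge : ∀ {𝒮 X} ρs → ρs ⊆ 𝒮 → Assuming 𝒮 ρs X → X
discharge []       ρs⊆𝒮 x = x
discharge (ρ ∷ ρs) ρs⊆𝒮 f = discharge ρs (ρs⊆𝒮 ∘ there) (f ⦃ ρs⊆𝒮 (here refl) ⦄)

module _ {𝓛 : Signature} where

  open Calculus 𝓛

  -- Equivalence

  ≈-setoid : Setoid _ _
  ≈-setoid = record
    { Carrier       = Structure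
    ; _≈_           = _≈_
    ; isEquivalence = record { refl = ≈-refl ; sym = ≈-sym ; trans = ≈-trans }
    }

  open SetoidReasoning ≈-setoid

  ⋁-congˡ : ∀ {R R′} T → R ≈ R′ → [ R , T ] ≈ [ R′ , T ]
  ⋁-congˡ T = ≈-context (⋁ [] hole (T ∷ []))

  ⋁-congʳ : ∀ R {T T′} → T ≈ T′ → [ R , T ] ≈ [ R , T′ ]
  ⋁-congʳ R = ≈-context (⋁ (R ∷ []) hole [])

  ⋁-cong : ∀ {R R′ T T′} → R ≈ R′ → T ≈ T′ → [ R , T ] ≈ [ R′ , T′ ]
  ⋁-cong p q = ≈-trans (⋁-congˡ _ p) (⋁-congʳ _ q)

  ⋀-congˡ : ∀ {R R′} T → R ≈ R′ → ⦅ R , T ⦆ ≈ ⦅ R′ , T ⦆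
  ⋀-congˡ T = ≈-context (⋀ [] hole (T ∷ []))

  ⋀-congʳ : ∀ R {T T′} → T ≈ T′ → ⦅ R , T ⦆ ≈ ⦅ R , T′ ⦆
  ⋀-congʳ R = ≈-context (⋀ (R ∷ []) hole [])

  ⋀-cong : ∀ {R R′ T T′} → R ≈ R′ → T ≈ T′ → ⦅ R , T ⦆ ≈ ⦅ R′ , T′ ⦆
  ⋀-cong p q = ≈-trans (⋀-congˡ _ p) (⋀-congʳ _ q)

  ∃-cong : ∀ {x R R′} → R ≈ R′ → ∃′ x R ≈ ∃′ x R′
  ∃-cong = ≈-context (∃′ _ hole)

  ∀-cong : ∀ {x R R′} → R ≈ R′ → ∀′ x R ≈ ∀′ x R′
  ∀-cong = ≈-context (∀′ _ hole)

  ⋁-identityʳ : ∀ R → [ R , 𝖿 ] ≈ R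
  ⋁-identityʳ R = ≈-trans (⋁-comm R 𝖿) (𝖿-⋁ R)

  ⋀-identityʳ : ∀ R → ⦅ R , 𝗍 ⦆ ≈ R
  ⋀-identityʳ R = ≈-trans (⋀-comm R 𝗍) (𝗍-⋀ R)

  ⋁-assocᵇ : ∀ R T U → [ [ R , T ] , U ] ≈ [ R , [ T , U ] ]
  ⋁-assocᵇ R T U = ≈-trans (⋁-assoc [] (R ∷ T ∷ []) (U ∷ []))
                    (≈-sym (⋁-assoc (R ∷ []) (T ∷ U ∷ []) []))

  ⋀-assocᵇ : ∀ R T U → ⦅ ⦅ R , T ⦆ , U ⦆ ≈ ⦅ R , ⦅ T , U ⦆ ⦆
  ⋀-assocᵇ R T U = ≈-trans (⋀-assoc [] (R ∷ T ∷ []) (U ∷ []))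
                    (≈-sym (⋀-assoc (R ∷ []) (T ∷ U ∷ []) []))

  -- With `U` and `V` equal to `R` and `T`, this pairs the two copies of each disjunct, so
  -- contracting a disjunction takes no rule beyond the contractions of its members.
  ⋁-interchange : ∀ R T U V → [ [ R , T ] , [ U , V ] ] ≈ [ [ R , U ] , [ T , V ] ]
  ⋁-interchange R T U V = begin
    [ [ R , T ] , [ U , V ] ]  ≈⟨ ⋁-assocᵇ R T _ ⟩
    [ R , [ T , [ U , V ] ] ]  ≈⟨ ⋁-congʳ R (⋁-assocᵇ T U V) ⟨
    [ R , [ [ T , U ] , V ] ]  ≈⟨ ⋁-congʳ R (⋁-congˡ V (⋁-comm T U)) ⟩
    [ R , [ [ U , T ] , V ] ]  ≈⟨ ⋁-congʳ R (⋁-assocᵇ U T V) ⟩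
    [ R , [ U , [ T , V ] ] ]  ≈⟨ ⋁-assocᵇ R U _ ⟨
    [ [ R , U ] , [ T , V ] ]  ∎

  ⋀-interchange : ∀ R T U V → ⦅ ⦅ R , T ⦆ , ⦅ U , V ⦆ ⦆ ≈ ⦅ ⦅ R , U ⦆ , ⦅ T , V ⦆ ⦆
  ⋀-interchange R T U V = begin
    ⦅ ⦅ R , T ⦆ , ⦅ U , V ⦆ ⦆  ≈⟨ ⋀-assocᵇ R T _ ⟩
    ⦅ R , ⦅ T , ⦅ U , V ⦆ ⦆ ⦆  ≈⟨ ⋀-congʳ R (⋀-assocᵇ T U V) ⟨
    ⦅ R , ⦅ ⦅ T , U ⦆ , V ⦆ ⦆  ≈⟨ ⋀-congʳ R (⋀-congˡ V (⋀-comm T U)) ⟩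
    ⦅ R , ⦅ ⦅ U , T ⦆ , V ⦆ ⦆  ≈⟨ ⋀-congʳ R (⋀-assocᵇ U T V) ⟩
    ⦅ R , ⦅ U , ⦅ T , V ⦆ ⦆ ⦆  ≈⟨ ⋀-assocᵇ R U _ ⟨
    ⦅ ⦅ R , U ⦆ , ⦅ T , V ⦆ ⦆  ∎

  -- Flattening requires an enclosing list, which the unit provides.
  ⋁-singleton : ∀ R → ⋁ (R ∷ []) ≈ R
  ⋁-singleton R = begin
    ⋁ (R ∷ [])          ≈⟨ 𝖿-⋁ _ ⟨
    [ 𝖿 , ⋁ (R ∷ []) ]  ≈⟨ ⋁-assoc (𝖿 ∷ []) (R ∷ []) [] ⟩
    [ 𝖿 , R ]           ≈⟨ 𝖿-⋁ R ⟩
    R                   ∎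

  ⋀-singleton : ∀ R → ⋀ (R ∷ []) ≈ R
  ⋀-singleton R = begin
    ⋀ (R ∷ [])          ≈⟨ 𝗍-⋀ _ ⟨
    ⦅ 𝗍 , ⋀ (R ∷ []) ⦆  ≈⟨ ⋀-assoc (𝗍 ∷ []) (R ∷ []) [] ⟩
    ⦅ 𝗍 , R ⦆           ≈⟨ 𝗍-⋀ R ⟩
    R                   ∎

  ⋁-cons : ∀ R T Ts → [ R , ⋁ (T ∷ Ts) ] ≈ ⋁ (R ∷ T ∷ Ts)
  -- With an empty tail, `⋁-assoc` yields `Ts ++ []`, which does not compute to `Ts`.
  ⋁-cons R T Ts = subst (λ Us → [ R , ⋁ (T ∷ Ts) ] ≈ ⋁ (R ∷ T ∷ Us))
    (++-identityʳ Ts) (⋁-assoc (R ∷ []) (T ∷ Ts) [])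

  ⋀-cons : ∀ R T Ts → ⦅ R , ⋀ (T ∷ Ts) ⦆ ≈ ⋀ (R ∷ T ∷ Ts)
  ⋀-cons R T Ts = subst (λ Us → ⦅ R , ⋀ (T ∷ Ts) ⦆ ≈ ⋀ (R ∷ T ∷ Us))
    (++-identityʳ Ts) (⋀-assoc (R ∷ []) (T ∷ Ts) [])

  ∃-𝖿 : ∀ {x} → ∃′ x 𝖿 ≈ 𝖿
  ∃-𝖿 = ∃-vacuous _ 𝖿 λ ()

  ∃-𝗍 : ∀ {x} → ∃′ x 𝗍 ≈ 𝗍
  ∃-𝗍 = ∃-vacuous _ 𝗍 λ ()

  ∀-𝖿 : ∀ {x} → ∀′ x 𝖿 ≈ 𝖿
  ∀-𝖿 = ∀-vacuous _ 𝖿 λ ()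

  ∀-𝗍 : ∀ {x} → ∀′ x 𝗍 ≈ 𝗍
  ∀-𝗍 = ∀-vacuous _ 𝗍 λ ()

  -- Negation normal forms up to ≈: a negation occurs in an atom only.
  data Generated : Structure → Set where
    𝖿    : Generated 𝖿
    𝗍    : Generated 𝗍
    atom : ∀ {a} → IsAtom a → Generated a
    disj : ∀ {R T} → Generated R → Generated T → Generated [ R , T ]
    conj : ∀ {R T} → Generated R → Generated T → Generated ⦅ R , T ⦆
    ∃′   : ∀ {x R} → Generated R → Generated (∃′ x R)
    ∀′   : ∀ {x R} → Generated R → Generated (∀′ x R)
    resp : ∀ {R T} → R ≈ T → Generated R → Generated T

  mutual
    generated : ∀ R → Generated R
    generated 𝖿          = 𝖿
    generated 𝗍          = 𝗍
    generated (pred p _) = atom pred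
    generated (⋁ (R ∷ Rs)) = generated-⋁ R Rs
    generated (⋀ (R ∷ Rs)) = generated-⋀ R Rs
    generated (neg R)    = generated-neg R
    generated (∃′ x R)   = ∃′ (generated R)
    generated (∀′ x R)   = ∀′ (generated R)

    generated-⋁ : ∀ R Rs → Generated (⋁ (R ∷ Rs))
    generated-⋁ R []       = resp (≈-sym (⋁-singleton R)) (generated R)
    generated-⋁ R (T ∷ Ts) = resp (⋁-cons R T Ts) (disj (generated R) (generated-⋁ T Ts))

    generated-⋀ : ∀ R Rs → Generated (⋀ (R ∷ Rs))
    generated-⋀ R []       = resp (≈-sym (⋀-singleton R)) (generated R)
    generated-⋀ R (T ∷ Ts) = resp (⋀-cons R T Ts) (conj (generated R) (generated-⋀ T Ts))

    -- The recursion runs on the structure under the negation, so pushing the negation inwards stays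
    -- structural although the De Morgan duals are new structures.
    generated-neg : ∀ R → Generated (neg R)
    generated-neg 𝖿            = resp (≈-sym neg-𝖿) 𝗍
    generated-neg 𝗍            = resp (≈-sym neg-𝗍) 𝖿
    generated-neg (pred p _)   = atom (neg pred)
    generated-neg (⋁ (R ∷ Rs)) = generated-neg-⋁ R Rs
    generated-neg (⋀ (R ∷ Rs)) = generated-neg-⋀ R Rs
    generated-neg (neg R)      = resp (≈-sym (neg-neg R)) (generated R)
    generated-neg (∃′ x R)     = resp (≈-sym (neg-∃ x R)) (∀′ (generated-neg R))
    generated-neg (∀′ x R)     = resp (≈-sym (neg-∀ x R)) (∃′ (generated-neg R))

    -- De Morgan is given for two members only, so one member is split off at a time. Contexts have
    -- no hole under a negation, so `≈-neg` carries the regrouping there.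
    generated-neg-⋁ : ∀ R Rs → Generated (neg (⋁ (R ∷ Rs)))
    generated-neg-⋁ R []       = resp (≈-neg (≈-sym (⋁-singleton R))) (generated-neg R)
    generated-neg-⋁ R (T ∷ Ts) =
      resp (≈-trans (≈-sym (neg-⋁ R _)) (≈-neg (⋁-cons R T Ts)))
        (conj (generated-neg R) (generated-neg-⋁ T Ts))

    generated-neg-⋀ : ∀ R Rs → Generated (neg (⋀ (R ∷ Rs)))
    generated-neg-⋀ R []       = resp (≈-neg (≈-sym (⋀-singleton R))) (generated-neg R)
    generated-neg-⋀ R (T ∷ Ts) =
      resp (≈-trans (≈-sym (neg-⋀ R _)) (≈-neg (⋀-cons R T Ts)))
        (disj (generated-neg R) (generated-neg-⋀ T Ts))

  -- Derivations

  infixr 9 _∘ᶜ_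
  _∘ᶜ_ : Context → Context → Context
  hole      ∘ᶜ S′ = S′
  ⋁ Ts S Us ∘ᶜ S′ = ⋁ Ts (S ∘ᶜ S′) Us
  ⋀ Ts S Us ∘ᶜ S′ = ⋀ Ts (S ∘ᶜ S′) Us
  ∃′ x S    ∘ᶜ S′ = ∃′ x (S ∘ᶜ S′)
  ∀′ x S    ∘ᶜ S′ = ∀′ x (S ∘ᶜ S′)

  ∘ᶜ-⟨⟩ : ∀ S S′ R → (S ∘ᶜ S′) ⟨ R ⟩ ≡ S ⟨ S′ ⟨ R ⟩ ⟩
  ∘ᶜ-⟨⟩ hole         S′ R = refl
  ∘ᶜ-⟨⟩ (⋁ Ts S Us)  S′ R rewrite ∘ᶜ-⟨⟩ S S′ R = refl
  ∘ᶜ-⟨⟩ (⋀ Ts S Us)  S′ R rewrite ∘ᶜ-⟨⟩ S S′ R = refl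
  ∘ᶜ-⟨⟩ (∃′ x S)     S′ R = cong (∃′ x) (∘ᶜ-⟨⟩ S S′ R)
  ∘ᶜ-⟨⟩ (∀′ x S)     S′ R = cong (∀′ x) (∘ᶜ-⟨⟩ S S′ R)

  module _ {𝒮 : System} where

    derivation-trans : ∀ {R T U} → Derivation 𝒮 R T → Derivation 𝒮 T U → Derivation 𝒮 R U
    derivation-trans (single p)       (single q)       = single (≈-trans p q)
    derivation-trans (single p)       (step ρ∈𝒮 q i d) = step ρ∈𝒮 (≈-trans p q) i d
    derivation-trans (step ρ∈𝒮 p i d) e                = step ρ∈𝒮 p i (derivation-trans d e)

    instance-context : ∀ S {ρ P Q} → Instance ρ P Q → Instance ρ (S ⟨ P ⟩) (S ⟨ Q ⟩)
    instance-context S {ρ} (inst S′ {P} {Q} r) =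
      subst₂ (Instance ρ) (∘ᶜ-⟨⟩ S S′ P) (∘ᶜ-⟨⟩ S S′ Q) (inst (S ∘ᶜ S′) r)

    -- Rules apply at any depth, and a hole never lies under a negation, so derivations keep their
    -- direction when placed in a context.
    derivation-context : ∀ S {P Q} → Derivation 𝒮 P Q → Derivation 𝒮 (S ⟨ P ⟩) (S ⟨ Q ⟩)
    derivation-context S (single p)       = single (≈-context S p)
    derivation-context S (step ρ∈𝒮 p i d) =
      step ρ∈𝒮 (≈-context S p) (instance-context S i) (derivation-context S d)

    ⋁-mono : ∀ {R R′ T T′} → Derivation 𝒮 R R′ → Derivation 𝒮 T T′ →
             Derivation 𝒮 [ R , T ] [ R′ , T′ ]
    ⋁-mono {R′ = R′} {T = T} d e = derivation-trans
      (derivation-context (⋁ [] hole (T ∷ [])) d)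
      (derivation-context (⋁ (R′ ∷ []) hole []) e)

    ⋀-mono : ∀ {R R′ T T′} → Derivation 𝒮 R R′ → Derivation 𝒮 T T′ →
             Derivation 𝒮 ⦅ R , T ⦆ ⦅ R′ , T′ ⦆
    ⋀-mono {R′ = R′} {T = T} d e = derivation-trans
      (derivation-context (⋀ [] hole (T ∷ [])) d)
      (derivation-context (⋀ (R′ ∷ []) hole []) e)

    ∃-mono : ∀ {x R R′} → Derivation 𝒮 R R′ → Derivation 𝒮 (∃′ x R) (∃′ x R′)
    ∃-mono = derivation-context (∃′ _ hole)

    ∀-mono : ∀ {x R R′} → Derivation 𝒮 R R′ → Derivation 𝒮 (∀′ x R) (∀′ x R′)
    ∀-mono = derivation-context (∀′ _ hole)

    rule : ∀ {ρ P Q} → ⦃ ρ ∈ 𝒮 ⦄ → Redex ρ P Q → Derivation 𝒮 P Q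
    rule ⦃ ρ∈𝒮 ⦄ r = step ρ∈𝒮 ≈-refl (inst hole r) (single ≈-refl)

  -- Simulation of one system by another

  Derivable : System → Rule → Set
  Derivable 𝒮 ρ = ∀ {P Q} → Redex ρ P Q → Derivation 𝒮 P Q

  -- Derivability of each rule in the empty context suffices: the derivation replacing a step is put
  -- into the context of that step.
  simulation : ∀ {𝒮 𝒮′} → All (Derivable 𝒮′) 𝒮 → ∀ {T R} → Derivation 𝒮 T R → Derivation 𝒮′ T R
  simulation rs (single p)                = single p
  simulation rs (step ρ∈𝒮 p (inst S r) d) = derivation-trans (single p)
    (derivation-trans (derivation-context S (lookup rs ρ∈𝒮 r)) (simulation rs d))

  module _ {𝒮 : System} where

    preorder : Preorder _ _ _
    preorder = record
      { Carrier    = Structure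
      ; _≈_        = _≈_
      ; _≲_        = Derivation 𝒮
      ; isPreorder = record
        { isEquivalence = Setoid.isEquivalence ≈-setoid
        ; reflexive     = single
        ; trans         = derivation-trans
        }
      }

    private module D = PreorderReasoning preorder

    -- Decomposition of the general rules

    -- Atomic weakening does not reach the units. Switch with `R` and `U` both `𝗍` and `T` equal to
    -- `𝖿` moves a `𝗍` out of the conjunction that holds `𝖿`.
    𝖿⟶𝗍 : ⦃ s ∈ 𝒮 ⦄ → Derivation 𝒮 𝖿 𝗍
    𝖿⟶𝗍 = D.begin
      𝖿                      D.≈⟨ 𝗍-⋀ 𝖿 ⟨
      ⦅ 𝗍 , 𝖿 ⦆              D.≈⟨ ⋀-congˡ 𝖿 𝗍-⋁ ⟨
      ⦅ [ 𝗍 , 𝗍 ] , 𝖿 ⦆      D.≲⟨ rule s ⟩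
      [ ⦅ 𝗍 , 𝖿 ⦆ , 𝗍 ]      D.≈⟨ ⋁-congˡ 𝗍 (𝗍-⋀ 𝖿) ⟩
      [ 𝖿 , 𝗍 ]              D.≈⟨ 𝖿-⋁ 𝗍 ⟩
      𝗍                      D.∎

    -- Up to `≈`, `𝖿` is its own disjunction, conjunction and quantification, so it can be spread
    -- over the shape of `R` and weakened at the leaves.
    weakening : ⦃ aw↓ ∈ 𝒮 ⦄ → ⦃ s ∈ 𝒮 ⦄ → ∀ {R} → Generated R → Derivation 𝒮 𝖿 R
    weakening 𝖿          = single ≈-refl
    weakening 𝗍          = 𝖿⟶𝗍
    weakening (atom a)   = rule (aw↓ a)
    weakening (disj g h) = derivation-trans (single (≈-sym (𝖿-⋁ 𝖿))) (⋁-mono (weakening g) (weakening h))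
    weakening (conj g h) = derivation-trans (single (≈-sym 𝖿-⋀)) (⋀-mono (weakening g) (weakening h))
    weakening (∃′ g)     = derivation-trans (single (≈-sym ∃-𝖿)) (∃-mono (weakening g))
    weakening (∀′ g)     = derivation-trans (single (≈-sym ∀-𝖿)) (∀-mono (weakening g))
    weakening (resp p g) = derivation-trans (weakening g) (single p)

    coweakening : ⦃ aw↑ ∈ 𝒮 ⦄ → ⦃ s ∈ 𝒮 ⦄ → ∀ {R} → Generated R → Derivation 𝒮 R 𝗍
    coweakening 𝖿          = 𝖿⟶𝗍
    coweakening 𝗍          = single ≈-refl
    coweakening (atom a)   = rule (aw↑ a)
    coweakening (disj g h) = derivation-trans (⋁-mono (coweakening g) (coweakening h)) (single 𝗍-⋁)
    coweakening (conj g h) = derivation-trans (⋀-mono (coweakening g) (coweakening h)) (single (𝗍-⋀ 𝗍))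
    coweakening (∃′ g)     = derivation-trans (∃-mono (coweakening g)) (single ∃-𝗍)
    coweakening (∀′ g)     = derivation-trans (∀-mono (coweakening g)) (single ∀-𝗍)
    coweakening (resp p g) = derivation-trans (single (≈-sym p)) (coweakening g)

    contraction : ⦃ ac↓ ∈ 𝒮 ⦄ → ⦃ m ∈ 𝒮 ⦄ → ⦃ l₁↓ ∈ 𝒮 ⦄ → ⦃ l₂↓ ∈ 𝒮 ⦄ →
                  ∀ {R} → Generated R → Derivation 𝒮 [ R , R ] R
    contraction 𝖿          = single (𝖿-⋁ 𝖿)
    contraction 𝗍          = single 𝗍-⋁
    contraction (atom a)   = rule (ac↓ a)
    contraction (disj g h) = derivation-trans (single (⋁-interchange _ _ _ _))
                               (⋁-mono (contraction g) (contraction h))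
    contraction (conj g h) = derivation-trans (rule m) (⋀-mono (contraction g) (contraction h))
    contraction (∃′ g)     = derivation-trans (rule l₁↓) (∃-mono (contraction g))
    contraction (∀′ g)     = derivation-trans (rule l₂↓) (∀-mono (contraction g))
    contraction (resp p g) = derivation-trans (single (⋁-cong (≈-sym p) (≈-sym p)))
                               (derivation-trans (contraction g) (single p))

    -- Medial is self-dual: read from its premise, it merges the doubled disjuncts here just as it
    -- splits doubled conjunctions in `contraction`.
    cocontraction : ⦃ ac↑ ∈ 𝒮 ⦄ → ⦃ m ∈ 𝒮 ⦄ → ⦃ l₁↑ ∈ 𝒮 ⦄ → ⦃ l₂↑ ∈ 𝒮 ⦄ →
                    ∀ {R} → Generated R → Derivation 𝒮 R ⦅ R , R ⦆
    cocontraction 𝖿          = single (≈-sym 𝖿-⋀)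
    cocontraction 𝗍          = single (≈-sym (𝗍-⋀ 𝗍))
    cocontraction (atom a)   = rule (ac↑ a)
    cocontraction (disj g h) = derivation-trans (⋁-mono (cocontraction g) (cocontraction h)) (rule m)
    cocontraction (conj g h) = derivation-trans (⋀-mono (cocontraction g) (cocontraction h))
                                 (single (⋀-interchange _ _ _ _))
    cocontraction (∃′ g)     = derivation-trans (∃-mono (cocontraction g)) (rule l₂↑)
    cocontraction (∀′ g)     = derivation-trans (∀-mono (cocontraction g)) (rule l₁↑)
    cocontraction (resp p g) = derivation-trans (single (≈-sym p))
                                 (derivation-trans (cocontraction g) (single (⋀-cong p p)))

    -- `R′` and `T′` are arbitrary rather than negations, so that disjunctions and conjunctions are
    -- both covered, the latter with the two sides exchanged.
    interaction-⋁⋀ : ⦃ s ∈ 𝒮 ⦄ → ∀ {R R′ T T′} →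
                     Derivation 𝒮 𝗍 [ R , R′ ] → Derivation 𝒮 𝗍 [ T , T′ ] →
                     Derivation 𝒮 𝗍 [ [ R , T ] , ⦅ R′ , T′ ⦆ ]
    interaction-⋁⋀ {R} {R′} {T} {T′} d e = D.begin
      𝗍                                D.≈⟨ 𝗍-⋀ 𝗍 ⟨
      ⦅ 𝗍 , 𝗍 ⦆                        D.≲⟨ ⋀-mono d e ⟩
      ⦅ [ R , R′ ] , [ T , T′ ] ⦆      D.≈⟨ ⋀-cong (⋁-comm R R′) (⋁-comm T T′) ⟩
      -- Switch releases the right member of a disjunction, so `R` and `T` are moved there; the
      -- first switch then frees `R`, the second `T`.
      ⦅ [ R′ , R ] , [ T′ , T ] ⦆      D.≲⟨ rule s ⟩
      [ ⦅ R′ , [ T′ , T ] ⦆ , R ]      D.≈⟨ ⋁-congˡ R (⋀-comm R′ _) ⟩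
      [ ⦅ [ T′ , T ] , R′ ⦆ , R ]      D.≲⟨ ⋁-mono (rule s) (single ≈-refl) ⟩
      [ [ ⦅ T′ , R′ ⦆ , T ] , R ]      D.≈⟨ ⋁-assocᵇ _ T R ⟩
      [ ⦅ T′ , R′ ⦆ , [ T , R ] ]      D.≈⟨ ⋁-comm _ _ ⟩
      [ [ T , R ] , ⦅ T′ , R′ ⦆ ]      D.≈⟨ ⋁-cong (⋁-comm T R) (⋀-comm T′ R′) ⟩
      [ [ R , T ] , ⦅ R′ , T′ ⦆ ]      D.∎

    -- A single switch brings `R′` to `R`, where `d` turns the pair into `𝖿`; this unit vanishes and
    -- leaves exactly the premise of `e`.
    cointeraction-⋁⋀ : ⦃ s ∈ 𝒮 ⦄ → ∀ {R R′ T T′} →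
                       Derivation 𝒮 ⦅ R , R′ ⦆ 𝖿 → Derivation 𝒮 ⦅ T , T′ ⦆ 𝖿 →
                       Derivation 𝒮 ⦅ [ R , T ] , ⦅ R′ , T′ ⦆ ⦆ 𝖿
    cointeraction-⋁⋀ {R} {R′} {T} {T′} d e = D.begin
      ⦅ [ R , T ] , ⦅ R′ , T′ ⦆ ⦆      D.≈⟨ ⋀-assocᵇ _ R′ T′ ⟨
      ⦅ ⦅ [ R , T ] , R′ ⦆ , T′ ⦆      D.≲⟨ ⋀-mono (rule s) (single ≈-refl) ⟩
      ⦅ [ ⦅ R , R′ ⦆ , T ] , T′ ⦆      D.≲⟨ ⋀-mono (⋁-mono d (single ≈-refl)) (single ≈-refl) ⟩
      ⦅ [ 𝖿 , T ] , T′ ⦆               D.≈⟨ ⋀-congˡ T′ (𝖿-⋁ T) ⟩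
      ⦅ T , T′ ⦆                       D.≲⟨ e ⟩
      𝖿                                D.∎

    interaction-∃∀ : ⦃ u↓ ∈ 𝒮 ⦄ → ∀ {x R R′} →
                     Derivation 𝒮 𝗍 [ R , R′ ] → Derivation 𝒮 𝗍 [ ∃′ x R , ∀′ x R′ ]
    interaction-∃∀ {x} {R} {R′} d = D.begin
      𝗍                        D.≈⟨ ∀-𝗍 ⟨
      ∀′ x 𝗍                   D.≲⟨ ∀-mono d ⟩
      ∀′ x [ R , R′ ]          D.≈⟨ ∀-cong (⋁-comm R R′) ⟩
      -- `u↓` keeps the universal quantifier on the left member, hence the exchange before and after
      -- it.
      ∀′ x [ R′ , R ]          D.≲⟨ rule u↓ ⟩
      [ ∀′ x R′ , ∃′ x R ]     D.≈⟨ ⋁-comm _ _ ⟩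
      [ ∃′ x R , ∀′ x R′ ]     D.∎

    cointeraction-∃∀ : ⦃ u↑ ∈ 𝒮 ⦄ → ∀ {x R R′} →
                       Derivation 𝒮 ⦅ R , R′ ⦆ 𝖿 → Derivation 𝒮 ⦅ ∃′ x R , ∀′ x R′ ⦆ 𝖿
    cointeraction-∃∀ {x} {R} {R′} d = D.begin
      ⦅ ∃′ x R , ∀′ x R′ ⦆     D.≲⟨ rule u↑ ⟩
      ∃′ x ⦅ R , R′ ⦆          D.≲⟨ ∃-mono d ⟩
      ∃′ x 𝖿                   D.≈⟨ ∃-𝖿 ⟩
      𝖿                        D.∎

    interaction-comm : ∀ {R T} → Derivation 𝒮 𝗍 [ R , T ] → Derivation 𝒮 𝗍 [ T , R ]
    interaction-comm d = derivation-trans d (single (⋁-comm _ _))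

    cointeraction-comm : ∀ {R T} → Derivation 𝒮 ⦅ R , T ⦆ 𝖿 → Derivation 𝒮 ⦅ T , R ⦆ 𝖿
    cointeraction-comm d = derivation-trans (single (⋀-comm _ _)) d

    interaction : ⦃ ai↓ ∈ 𝒮 ⦄ → ⦃ s ∈ 𝒮 ⦄ → ⦃ u↓ ∈ 𝒮 ⦄ →
                  ∀ {R} → Generated R → Derivation 𝒮 𝗍 [ R , neg R ]
    interaction 𝖿          = single (≈-sym (≈-trans (𝖿-⋁ _) neg-𝖿))
    interaction 𝗍          = single (≈-sym (≈-trans (⋁-congʳ 𝗍 neg-𝗍) (⋁-identityʳ 𝗍)))
    interaction (atom a)   = rule (ai↓ a)
    interaction (disj g h) = derivation-trans (interaction-⋁⋀ (interaction g) (interaction h))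
      (single (⋁-congʳ _ (≈-sym (neg-⋁ _ _))))
    interaction (conj g h) = derivation-trans
      -- The negations take the part of the disjuncts, and the conjunction itself is the second
      -- member.
      (interaction-comm (interaction-⋁⋀ (interaction-comm (interaction g)) (interaction-comm (interaction h))))
      (single (⋁-congʳ _ (≈-sym (neg-⋀ _ _))))
    interaction (∃′ g)     = derivation-trans (interaction-∃∀ (interaction g))
      (single (⋁-congʳ _ (≈-sym (neg-∃ _ _))))
    interaction (∀′ g)     = derivation-trans
      (interaction-comm (interaction-∃∀ (interaction-comm (interaction g))))
      (single (⋁-congʳ _ (≈-sym (neg-∀ _ _))))
    interaction (resp p g) = derivation-trans (interaction g) (single (⋁-cong p (≈-neg p)))

    cointeraction : ⦃ ai↑ ∈ 𝒮 ⦄ → ⦃ s ∈ 𝒮 ⦄ → ⦃ u↑ ∈ 𝒮 ⦄ →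
                    ∀ {R} → Generated R → Derivation 𝒮 ⦅ R , neg R ⦆ 𝖿
    cointeraction 𝖿          = single (≈-trans (⋀-congʳ 𝖿 neg-𝖿) (⋀-identityʳ 𝖿))
    cointeraction 𝗍          = single (≈-trans (𝗍-⋀ _) neg-𝗍)
    cointeraction (atom a)   = rule (ai↑ a)
    cointeraction (disj g h) = derivation-trans (single (⋀-congʳ _ (neg-⋁ _ _)))
      (cointeraction-⋁⋀ (cointeraction g) (cointeraction h))
    cointeraction (conj g h) = derivation-trans (single (⋀-congʳ _ (neg-⋀ _ _)))
      (cointeraction-comm
        (cointeraction-⋁⋀ (cointeraction-comm (cointeraction g)) (cointeraction-comm (cointeraction h))))
    cointeraction (∃′ g)     = derivation-trans (single (⋀-congʳ _ (neg-∃ _ _)))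
      (cointeraction-∃∀ (cointeraction g))
    cointeraction (∀′ g)     = derivation-trans (single (⋀-congʳ _ (neg-∀ _ _)))
      (cointeraction-comm (cointeraction-∃∀ (cointeraction-comm (cointeraction g))))
    cointeraction (resp p g) = derivation-trans
      (single (⋀-cong (≈-sym p) (≈-neg (≈-sym p)))) (cointeraction g)

    i↓-derivable : ⦃ ai↓ ∈ 𝒮 ⦄ → ⦃ s ∈ 𝒮 ⦄ → ⦃ u↓ ∈ 𝒮 ⦄ → Derivable 𝒮 i↓
    i↓-derivable i↓ = interaction (generated _)

    i↑-derivable : ⦃ ai↑ ∈ 𝒮 ⦄ → ⦃ s ∈ 𝒮 ⦄ → ⦃ u↑ ∈ 𝒮 ⦄ → Derivable 𝒮 i↑
    i↑-derivable i↑ = cointeraction (generated _)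

    w↓-derivable : ⦃ aw↓ ∈ 𝒮 ⦄ → ⦃ s ∈ 𝒮 ⦄ → Derivable 𝒮 w↓
    w↓-derivable w↓ = weakening (generated _)

    w↑-derivable : ⦃ aw↑ ∈ 𝒮 ⦄ → ⦃ s ∈ 𝒮 ⦄ → Derivable 𝒮 w↑
    w↑-derivable w↑ = coweakening (generated _)

    c↓-derivable : ⦃ ac↓ ∈ 𝒮 ⦄ → ⦃ m ∈ 𝒮 ⦄ → ⦃ l₁↓ ∈ 𝒮 ⦄ → ⦃ l₂↓ ∈ 𝒮 ⦄ → Derivable 𝒮 c↓
    c↓-derivable c↓ = contraction (generated _)

    c↑-derivable : ⦃ ac↑ ∈ 𝒮 ⦄ → ⦃ m ∈ 𝒮 ⦄ → ⦃ l₁↑ ∈ 𝒮 ⦄ → ⦃ l₂↑ ∈ 𝒮 ⦄ → Derivable 𝒮 c↑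
    c↑-derivable c↑ = cocontraction (generated _)

    -- Derivations from the general rules

    ai↓-derivable : ⦃ i↓ ∈ 𝒮 ⦄ → Derivable 𝒮 ai↓
    ai↓-derivable (ai↓ _) = rule i↓

    ai↑-derivable : ⦃ i↑ ∈ 𝒮 ⦄ → Derivable 𝒮 ai↑
    ai↑-derivable (ai↑ _) = rule i↑

    aw↓-derivable : ⦃ w↓ ∈ 𝒮 ⦄ → Derivable 𝒮 aw↓
    aw↓-derivable (aw↓ _) = rule w↓

    aw↑-derivable : ⦃ w↑ ∈ 𝒮 ⦄ → Derivable 𝒮 aw↑
    aw↑-derivable (aw↑ _) = rule w↑

    ac↓-derivable : ⦃ c↓ ∈ 𝒮 ⦄ → Derivable 𝒮 ac↓
    ac↓-derivable (ac↓ _) = rule c↓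

    ac↑-derivable : ⦃ c↑ ∈ 𝒮 ⦄ → Derivable 𝒮 ac↑
    ac↑-derivable (ac↑ _) = rule c↑

    -- The unit `𝖿` is always present as a silent disjunct and can be weakened to `T`.
    ⋁-introˡ : ⦃ w↓ ∈ 𝒮 ⦄ → ∀ {R T} → Derivation 𝒮 R [ R , T ]
    ⋁-introˡ {R} {T} = derivation-trans (single (≈-sym (⋁-identityʳ R)))
      (⋁-mono (single ≈-refl) (rule w↓))

    ⋁-introʳ : ⦃ w↓ ∈ 𝒮 ⦄ → ∀ {R T} → Derivation 𝒮 T [ R , T ]
    ⋁-introʳ {R} {T} = derivation-trans ⋁-introˡ (single (⋁-comm T R))

    -- Together with the introductions this makes disjunction a join for derivability, so a monotone
    -- operation commutes with it in one direction; `m`, `l₁↓` and `l₂↓` are instances.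
    ⋁-elim : ⦃ c↓ ∈ 𝒮 ⦄ → ∀ {R T U} →
             Derivation 𝒮 R U → Derivation 𝒮 T U → Derivation 𝒮 [ R , T ] U
    ⋁-elim d e = derivation-trans (⋁-mono d e) (rule c↓)

    ⋀-elimˡ : ⦃ w↑ ∈ 𝒮 ⦄ → ∀ {R T} → Derivation 𝒮 ⦅ R , T ⦆ R
    ⋀-elimˡ {R} {T} = derivation-trans (⋀-mono (single ≈-refl) (rule w↑)) (single (⋀-identityʳ R))

    ⋀-elimʳ : ⦃ w↑ ∈ 𝒮 ⦄ → ∀ {R T} → Derivation 𝒮 ⦅ R , T ⦆ T
    ⋀-elimʳ {R} {T} = derivation-trans (single (⋀-comm R T)) ⋀-elimˡ

    ⋀-intro : ⦃ c↑ ∈ 𝒮 ⦄ → ∀ {R T U} →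
              Derivation 𝒮 U R → Derivation 𝒮 U T → Derivation 𝒮 U ⦅ R , T ⦆
    ⋀-intro d e = derivation-trans (rule c↑) (⋀-mono d e)

    -- Each disjunct of the premise yields the conclusion by weakening inside its conjunction. Only
    -- down rules occur, so this also serves `KSgq`.
    m-derivable : ⦃ w↓ ∈ 𝒮 ⦄ → ⦃ c↓ ∈ 𝒮 ⦄ → Derivable 𝒮 m
    m-derivable m = ⋁-elim (⋀-mono ⋁-introˡ ⋁-introˡ) (⋀-mono ⋁-introʳ ⋁-introʳ)

    l₁↓-derivable : ⦃ w↓ ∈ 𝒮 ⦄ → ⦃ c↓ ∈ 𝒮 ⦄ → Derivable 𝒮 l₁↓
    l₁↓-derivable l₁↓ = ⋁-elim (∃-mono ⋁-introˡ) (∃-mono ⋁-introʳ)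

    l₂↓-derivable : ⦃ w↓ ∈ 𝒮 ⦄ → ⦃ c↓ ∈ 𝒮 ⦄ → Derivable 𝒮 l₂↓
    l₂↓-derivable l₂↓ = ⋁-elim (∀-mono ⋁-introˡ) (∀-mono ⋁-introʳ)

    -- Dually, conjunction is a meet once `w↑` and `c↑` are present.
    l₁↑-derivable : ⦃ w↑ ∈ 𝒮 ⦄ → ⦃ c↑ ∈ 𝒮 ⦄ → Derivable 𝒮 l₁↑
    l₁↑-derivable l₁↑ = ⋀-intro (∀-mono ⋀-elimˡ) (∀-mono ⋀-elimʳ)

    l₂↑-derivable : ⦃ w↑ ∈ 𝒮 ⦄ → ⦃ c↑ ∈ 𝒮 ⦄ → Derivable 𝒮 l₂↑
    l₂↑-derivable l₂↑ = ⋀-intro (∃-mono ⋀-elimˡ) (∃-mono ⋀-elimʳ)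

  -- The two strong equivalences

  SKSq⇒SKSgq : All (Derivable SKSgq) SKSq
  SKSq⇒SKSgq = discharge SKSgq id
    ( ai↓-derivable ∷ ai↑-derivable ∷ rule ∷ m-derivable
    ∷ aw↓-derivable ∷ aw↑-derivable ∷ ac↓-derivable ∷ ac↑-derivable ∷ rule ∷ rule
    ∷ l₁↓-derivable ∷ l₁↑-derivable ∷ l₂↓-derivable ∷ l₂↑-derivable ∷ rule ∷ rule ∷ [] )

  SKSgq⇒SKSq : All (Derivable SKSq) SKSgq
  SKSgq⇒SKSq = discharge SKSq id
    ( i↓-derivable ∷ i↑-derivable ∷ rule ∷ w↓-derivable ∷ w↑-derivable
    ∷ c↓-derivable ∷ c↑-derivable ∷ rule ∷ rule ∷ rule ∷ rule ∷ [] )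

  KSq⇒KSgq : All (Derivable KSgq) KSq
  KSq⇒KSgq = discharge KSgq id
    ( ai↓-derivable ∷ rule ∷ m-derivable ∷ aw↓-derivable ∷ ac↓-derivable ∷ rule
    ∷ l₁↓-derivable ∷ l₂↓-derivable ∷ rule ∷ [] )

  KSgq⇒KSq : All (Derivable KSq) KSgq
  KSgq⇒KSq = discharge KSq id
    ( i↓-derivable ∷ rule ∷ w↓-derivable ∷ c↓-derivable ∷ rule ∷ rule ∷ [] )

theorem4p15 : (𝓛 : Signature) →
    Calculus.StronglyEquivalent 𝓛 SKSq SKSgq × Calculus.StronglyEquivalent 𝓛 KSq KSgq
theorem4p15 𝓛 =
    (λ _ _ → mk⇔ (simulation SKSq⇒SKSgq) (simulation SKSgq⇒SKSq))
  , (λ _ _ → mk⇔ (simulation KSq⇒KSgq) (simulation KSgq⇒KSq))
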